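{- Let $\lambda(\bar y)=\exists x.\,\lambda_m(x,\bar y)$ be a formula of Linear Integer Arithmetic, with $\lambda_m$ quantifier-free, in negation normal form, and such that the only literals of $\lambda_m$ containing $x$ are of the form $\ell<x$, $x<u$, $x=e$ or $(d\mid\pm x+w)$, where the terms $\ell,u,e,w$ are $x$-free and $d\in\mathbb{Z}\setminus\{0\}$. Then $\mathrm{LIAProj}_\lambda$ is a Model Based Projection for $\lambda$.
   Context: **Model Based Projection.** Let $\mathit{Th}$ be a theory and $\lambda(\bar y)=\exists\bar x.\,\lambda_m(\bar x,\bar y)$ with $\lambda_m$ quantifier-free. A function $\mathrm{Proj}_\lambda$ from models (modulo $\mathit{Th}$, including values for the variables) of $\lambda_m$ to quantifier-free formulas over $\bar y$ is a Model Based Projection (for $\lambda$) iff (i) it has a finite image, (ii) $\lambda\equiv\bigvee_{M\models\lambda_m}\mathrm{Proj}_\lambda(M)$ (equivalence modulo $\mathit{Th}$), and (iii) $M\models\mathrm{Proj}_\lambda(M)$ for every model $M$ of $\lambda_m$. Here $\mathit{Th}$ is Linear Integer Arithmetic (LIA), with divisibility literals $a\mid b$ meaning "$a$ divides $b$". **Substitutions.** $\mathrm{lits}(\lambda)$ is the set of literals of $\lambda$. $D$ is the least common multiple of all the divisors $d$ in the divisibility literals of $\lambda_m$. For an $x$-free term $t$, $\lambda_m[t]$ is the result of substituting $t$ for $x$ in $\lambda_m$. $\lambda_m^{ -\infty}$ is obtained from $\lambda_m$ by substituting the non-divisibility literals containing $x$ by $(\ell<x)\mapsto\bot$, $(x<u)\mapsto\top$,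 $(x=e)\mapsto\bot$; and $\lambda_m^{ -\infty}[t]$ is the result of substituting $t$ for $x$ in $\lambda_m^{ -\infty}$. **Definition of $\mathrm{LIAProj}_\lambda$.** Write $M[t]$ for the value of a term $t$ in $M$. For $M\models\lambda_m$: - $\mathrm{LIAProj}_\lambda(M)=\lambda_m[e]$ if $(x=e)\in\mathrm{lits}(\lambda)$ and $M\models x=e$; - else $\mathrm{LIAProj}_\lambda(M)=\lambda_m[\ell+1+i_\ell]$ if $(\ell<x)\in\mathrm{lits}(\lambda)$, $M\models\ell<x$, and for all $(\ell'<x)\in\mathrm{lits}(\lambda)$, $M\models((\ell'<x)\Rightarrow(\ell'\le\ell))$, where $i_\ell=M[x-(\ell+1)]\bmod D$; - otherwise $\mathrm{LIAProj}_\lambda(M)=\lambda_m^{ -\infty}[i_{ -\infty}]$, where $i_{ -\infty}=M[x]\bmod D$. Conflicts between several eligible $e$ or several eligible $\ell$ are resolved by an arbitrary but fixed syntactic ordering on terms. -}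

module Defs where

open import Data.Empty using (⊥)
open import Data.Fin.Base using (Fin; zero; suc)
open import Data.Integer.Base as ℤ using (ℤ; +_; -[1+_]; ∣_∣)
import Data.Integer.DivMod as ℤ
import Data.Integer.Divisibility as ℤ
import Data.Integer.Properties as ℤ
open import Data.List.Base using (List; []; _∷_; [_]; _++_; map; mapMaybe; filter; foldr)
import Data.List.Extrema as Extrema
open import Data.List.Membership.Propositional using (_∈_)
open import Data.List.Relation.Unary.All using (All; all?)
open import Data.Maybe.Base as Maybe using (Maybe; just; nothing)
open import Data.Nat.Base as ℕ using (ℕ; suc; NonZero)
open import Data.Nat.GCD using (gcd)
open import Data.Nat.LCM using (lcm; gcd*lcm)
import Data.Nat.Properties as ℕ
open import Data.Product.Base using (_×_; ∃-syntax; Σ-syntax)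
open import Data.Sum.Base using (_⊎_)
open import Data.Unit.Base using (⊤)
open import Data.Vec.Base as Vec using (Vec; _∷_; lookup)
open import Function.Base using (_∘_)
open import Function.Bundles using (_⇔_)
open import Level using (Level)
open import Relation.Binary.Bundles using (TotalOrder)
open import Relation.Binary.Core using (Rel)
open import Relation.Binary.PropositionalEquality.Core using (_≡_; refl; sym; trans; cong; subst)
open import Relation.Binary.Structures using (IsTotalOrder)
open import Relation.Nullary.Decidable using (_×-dec_; _→-dec_)
open import Relation.Nullary.Negation using (¬_)
open import Relation.Unary using (Decidable)

private
  variable
    m n : ℕ
    r   : Level

infix  9 ⊝_
infixr 8 _⊙_
infixl 7 _⊕_
infix  6 _<ᵃ_ _≤ᵃ_ _≐_ _∣ᵃ_
infix  5 ¬ᶠ_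
infixr 4 _∧ᶠ_
infixr 3 _∨ᶠ_
infix  2 _⊨_ _⊨ᵃ_

data Term (n : ℕ) : Set where
  var : Fin n → Term n
  con : ℤ → Term n
  _⊕_ : Term n → Term n → Term n
  ⊝_  : Term n → Term n
  _⊙_ : ℤ → Term n → Term n

data Atom (n : ℕ) : Set where
  _<ᵃ_ _≤ᵃ_ _≐_ : Term n → Term n → Atom n
  _∣ᵃ_ : (d : ℤ) → .{{ℤ.NonZero d}} → Term n → Atom n

data Formula (n : ℕ) : Set where
  atom      : Atom n → Formula n
  ⊤ᶠ ⊥ᶠ     : Formula n
  ¬ᶠ_       : Formula n → Formula n
  _∧ᶠ_ _∨ᶠ_ : Formula n → Formula n → Formula n

data NNF {n : ℕ} : Formula n → Set where
  atom  : ∀ a → NNF (atom a)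
  ¬atom : ∀ a → NNF (¬ᶠ atom a)
  ⊤ᶠ    : NNF ⊤ᶠ
  ⊥ᶠ    : NNF ⊥ᶠ
  _∧ᶠ_  : ∀ {φ ψ} → NNF φ → NNF ψ → NNF (φ ∧ᶠ ψ)
  _∨ᶠ_  : ∀ {φ ψ} → NNF φ → NNF ψ → NNF (φ ∨ᶠ ψ)

data Literal (n : ℕ) : Set where
  pos neg : Atom n → Literal n

negate : Literal n → Literal n
negate (pos a) = neg a
negate (neg a) = pos a

lits : Formula n → List (Literal n)
lits (atom a) = [ pos a ]
lits ⊤ᶠ       = []
lits ⊥ᶠ       = []
lits (¬ᶠ φ)   = map negate (lits φ)
lits (φ ∧ᶠ ψ) = lits φ ++ lits ψ
lits (φ ∨ᶠ ψ) = lits φ ++ lits ψ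

Env : ℕ → Set
Env = Vec ℤ

⟦_⟧ : Term n → Env n → ℤ
⟦ var i ⟧ M = lookup M i
⟦ con k ⟧ M = k
⟦ s ⊕ t ⟧ M = ⟦ s ⟧ M ℤ.+ ⟦ t ⟧ M
⟦ ⊝ t ⟧   M = ℤ.- ⟦ t ⟧ M
⟦ k ⊙ t ⟧ M = k ℤ.* ⟦ t ⟧ M

_⊨ᵃ_ : Env n → Atom n → Set
M ⊨ᵃ s <ᵃ t = ⟦ s ⟧ M ℤ.< ⟦ t ⟧ M
M ⊨ᵃ s ≤ᵃ t = ⟦ s ⟧ M ℤ.≤ ⟦ t ⟧ M
M ⊨ᵃ s ≐ t  = ⟦ s ⟧ M ≡ ⟦ t ⟧ M
M ⊨ᵃ d ∣ᵃ t = d ℤ.∣ ⟦ t ⟧ M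

_⊨_ : Env n → Formula n → Set
M ⊨ atom a = M ⊨ᵃ a
M ⊨ ⊤ᶠ     = ⊤
M ⊨ ⊥ᶠ     = ⊥
M ⊨ ¬ᶠ φ   = ¬ (M ⊨ φ)
M ⊨ φ ∧ᶠ ψ = (M ⊨ φ) × (M ⊨ ψ)
M ⊨ φ ∨ᶠ ψ = (M ⊨ φ) ⊎ (M ⊨ ψ)

subᵗ : (Fin m → Term n) → Term m → Term n
subᵗ σ (var i) = σ i
subᵗ σ (con k) = con k
subᵗ σ (s ⊕ t) = subᵗ σ s ⊕ subᵗ σ t
subᵗ σ (⊝ t)   = ⊝ subᵗ σ t
subᵗ σ (k ⊙ t) = k ⊙ subᵗ σ t

subᵃ : (Fin m → Term n) → Atom m → Atom n
subᵃ σ (s <ᵃ t) = subᵗ σ s <ᵃ subᵗ σ t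
subᵃ σ (s ≤ᵃ t) = subᵗ σ s ≤ᵃ subᵗ σ t
subᵃ σ (s ≐ t)  = subᵗ σ s ≐ subᵗ σ t
subᵃ σ (d ∣ᵃ t) = d ∣ᵃ subᵗ σ t

sub : (Fin m → Term n) → Formula m → Formula n
sub σ (atom a) = atom (subᵃ σ a)
sub σ ⊤ᶠ       = ⊤ᶠ
sub σ ⊥ᶠ       = ⊥ᶠ
sub σ (¬ᶠ φ)   = ¬ᶠ sub σ φ
sub σ (φ ∧ᶠ ψ) = sub σ φ ∧ᶠ sub σ ψ
sub σ (φ ∨ᶠ ψ) = sub σ φ ∨ᶠ sub σ ψ

-- The eliminated variable x is variable zero; x-free terms are terms over
-- the remaining n variables, viewed over suc n variables through wkᵗ.

x : Term (suc n)
x = var zero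

wkᵗ : Term n → Term (suc n)
wkᵗ = subᵗ (var ∘ suc)

wkᵃ : Atom n → Atom (suc n)
wkᵃ = subᵃ (var ∘ suc)

_for-x : Term n → Fin (suc n) → Term n
(t for-x) zero    = t
(t for-x) (suc i) = var i

_[_/x] : Formula (suc n) → Term n → Formula n
φ [ t /x] = sub (t for-x) φ

-- The partial inverse of wkᵗ: defined exactly on the terms without x.
strengthen : Term (suc n) → Maybe (Term n)
strengthen (var zero)    = nothing
strengthen (var (suc i)) = just (var i)
strengthen (con k)       = just (con k)
strengthen (s ⊕ t)       = Maybe.zipWith _⊕_ (strengthen s) (strengthen t)
strengthen (⊝ t)         = Maybe.map ⊝_ (strengthen t)
strengthen (k ⊙ t)       = Maybe.map (k ⊙_) (strengthen t)

data ProjectableLiteral {n : ℕ} : Literal (suc n) → Set where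
  x-free⁺  : (a : Atom n) → ProjectableLiteral (pos (wkᵃ a))
  x-free⁻  : (a : Atom n) → ProjectableLiteral (neg (wkᵃ a))
  lower    : (ℓ : Term n) → ProjectableLiteral (pos (wkᵗ ℓ <ᵃ x))
  upper    : (u : Term n) → ProjectableLiteral (pos (x <ᵃ wkᵗ u))
  equal    : (e : Term n) → ProjectableLiteral (pos (x ≐ wkᵗ e))
  divides⁺ : (d : ℤ) .{{_ : ℤ.NonZero d}} (w : Term n) →
             ProjectableLiteral (pos (d ∣ᵃ x ⊕ wkᵗ w))
  divides⁻ : (d : ℤ) .{{_ : ℤ.NonZero d}} (w : Term n) →
             ProjectableLiteral (pos (d ∣ᵃ ⊝ x ⊕ wkᵗ w))

-- The model M assigns values to x̄ (the first m variables) and ȳ.  The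
-- disjunction of the projections of all models is satisfied by ȳ iff some
-- projection is.
record IsModelBasedProjection
         (m : ℕ) {n : ℕ} (λₘ : Formula (m ℕ.+ n))
         (Proj : (M : Env (m ℕ.+ n)) → .(M ⊨ λₘ) → Formula n) : Set where
  field
    finite-image : ∃[ ψs ] ((M : Env (m ℕ.+ n)) (p : M ⊨ λₘ) → Proj M p ∈ ψs)
    equivalent   : (ys : Env n) →
                   (∃[ xs ] (Vec._++_ {m = m} xs ys ⊨ λₘ)) ⇔
                   (∃[ M ] Σ[ p ∈ M ⊨ λₘ ] (ys ⊨ Proj M p))
    satisfied    : (M : Env (m ℕ.+ n)) (p : M ⊨ λₘ) → Vec.drop m M ⊨ Proj M p

-- Literals other than divisibilities contribute the neutral element of lcm.
divisor : Literal n → ℕ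
divisor (pos (d ∣ᵃ _)) = ∣ d ∣
divisor (neg (d ∣ᵃ _)) = ∣ d ∣
divisor _              = 1

D : Formula n → ℕ
D φ = foldr lcm 1 (map divisor (lits φ))

divisor-nonZero : (L : Literal n) → NonZero (divisor L)
divisor-nonZero (pos (_ <ᵃ _)) = _
divisor-nonZero (pos (_ ≤ᵃ _)) = _
divisor-nonZero (pos (_ ≐ _))  = _
divisor-nonZero (pos (_∣ᵃ_ (+ suc _) _)) = _
divisor-nonZero (pos (_∣ᵃ_ -[1+ _ ] _)) = _
divisor-nonZero (neg (_ <ᵃ _)) = _
divisor-nonZero (neg (_ ≤ᵃ _)) = _
divisor-nonZero (neg (_ ≐ _))  = _
divisor-nonZero (neg (_∣ᵃ_ (+ suc _) _)) = _
divisor-nonZero (neg (_∣ᵃ_ -[1+ _ ] _)) = _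

lcm-nonZero : ∀ i j → NonZero i → NonZero j → NonZero (lcm i j)
lcm-nonZero i j i≢0 j≢0 =
  ℕ.m*n≢0⇒n≢0 (gcd i j)
    {{subst NonZero (sym (gcd*lcm i j)) (ℕ.m*n≢0 i j {{i≢0}} {{j≢0}})}}

D-nonZero : (φ : Formula n) → NonZero (D φ)
D-nonZero φ = go (lits φ)
  where
  go : ∀ Ls → NonZero (foldr lcm 1 (map divisor Ls))
  go []       = _
  go (L ∷ Ls) = lcm-nonZero (divisor L) _ (divisor-nonZero L) (go Ls)

_mod-D_ : ℤ → Formula n → ℤ
k mod-D φ = + (k ℤ.%ℕ D φ) {{D-nonZero φ}}

lowerBound : Literal (suc n) → Maybe (Term n)
lowerBound (pos (s <ᵃ var zero)) = strengthen s
lowerBound _                     = nothing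

-- The ℓ with (ℓ < x) ∈ lits φ
lowers : Formula (suc n) → List (Term n)
lowers φ = mapMaybe lowerBound (lits φ)

equalTerm : Literal (suc n) → Maybe (Term n)
equalTerm (pos (var zero ≐ t)) = strengthen t
equalTerm _                    = nothing

-- The e with (x = e) ∈ lits φ
equals : Formula (suc n) → List (Term n)
equals φ = mapMaybe equalTerm (lits φ)

-- Projectable non-divisibility literals containing x are positive, so it
-- suffices to replace atoms.
_⁻∞ᵃ : Atom (suc n) → Formula (suc n)
(s <ᵃ var zero) ⁻∞ᵃ = ⊥ᶠ
(var zero <ᵃ t) ⁻∞ᵃ = ⊤ᶠ
(var zero ≐ t)  ⁻∞ᵃ = ⊥ᶠ
a               ⁻∞ᵃ = atom a

_⁻∞ : Formula (suc n) → Formula (suc n)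
atom a   ⁻∞ = a ⁻∞ᵃ
⊤ᶠ       ⁻∞ = ⊤ᶠ
⊥ᶠ       ⁻∞ = ⊥ᶠ
(¬ᶠ φ)   ⁻∞ = ¬ᶠ (φ ⁻∞)
(φ ∧ᶠ ψ) ⁻∞ = (φ ⁻∞) ∧ᶠ (ψ ⁻∞)
(φ ∨ᶠ ψ) ⁻∞ = (φ ⁻∞) ∨ᶠ (ψ ⁻∞)

-- v and ys are the values of x and ȳ in the model.

HoldingEqual : ℤ → Env n → Term n → Set
HoldingEqual v ys e = v ≡ ⟦ e ⟧ ys

holdingEqual? : (v : ℤ) (ys : Env n) → Decidable (HoldingEqual v ys)
holdingEqual? v ys e = v ℤ.≟ ⟦ e ⟧ ys

GreatestLower : Formula (suc n) → ℤ → Env n → Term n → Set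
GreatestLower φ v ys ℓ =
  ⟦ ℓ ⟧ ys ℤ.< v ×
  All (λ ℓ′ → ⟦ ℓ′ ⟧ ys ℤ.< v → ⟦ ℓ′ ⟧ ys ℤ.≤ ⟦ ℓ ⟧ ys) (lowers φ)

greatestLower? : (φ : Formula (suc n)) (v : ℤ) (ys : Env n) →
                 Decidable (GreatestLower φ v ys)
greatestLower? φ v ys ℓ =
  (⟦ ℓ ⟧ ys ℤ.<? v) ×-dec
  all? (λ ℓ′ → (⟦ ℓ′ ⟧ ys ℤ.<? v) →-dec (⟦ ℓ′ ⟧ ys ℤ.≤? ⟦ ℓ ⟧ ys)) (lowers φ)

module _ {_≼_ : Rel (Term n) r} (≼-isTotalOrder : IsTotalOrder _≡_ _≼_) where

  ≼-totalOrder : TotalOrder _ _ _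
  ≼-totalOrder = record { isTotalOrder = ≼-isTotalOrder }

  least : List (Term n) → Maybe (Term n)
  least []       = nothing
  least (t ∷ ts) = just (Extrema.min ≼-totalOrder t ts)

  LIAProj : (λₘ : Formula (suc n)) (M : Env (suc n)) → .(M ⊨ λₘ) → Formula n
  LIAProj λₘ (v ∷ ys) _
    with least (filter (holdingEqual? v ys) (equals λₘ))
       | least (filter (greatestLower? λₘ v ys) (lowers λₘ))
  ... | just e  | _       = λₘ [ e /x]
  ... | nothing | just ℓ  = λₘ [ ℓ ⊕ con (+ 1) ⊕ con iℓ /x]
    where iℓ = (v ℤ.- (⟦ ℓ ⟧ ys ℤ.+ + 1)) mod-D λₘ
  ... | nothing | nothing = (λₘ ⁻∞) [ con i₋∞ /x]
    where i₋∞ = v mod-D λₘ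

{-# OPTIONS --safe #-}
-- In negation normal form a formula can only become true when one of its
-- literals does, so every claim reduces to literals.  Suppose x = v holds in
-- the model and no equality on x does.  Decreasing x from v by a multiple of D
-- preserves the upper bounds and the divisibilities, and it preserves the lower
-- bounds as long as x stays above the greatest lower bound ℓ that v satisfies;
-- the least such value is ℓ + 1 + i_ℓ.  If v satisfies no lower bound at all, x
-- can be decreased indefinitely, and λ^{-∞}, which depends only on x mod D, is
-- the limit.
module Submission where

open import Defs
open import Data.Fin.Base using (Fin; zero; suc)
open import Data.Integer.Base as ℤ using (ℤ; +_; ∣_∣; +≤+; +<+)
import Data.Integer.DivMod as ℤ
import Data.Integer.Divisibility as Unsigned
open import Data.Integer.Divisibility.Signed
  using (_∣_; divides; ∣ᵤ⇒∣; ∣⇒∣ᵤ; ∣-trans; ∣m∣n⇒∣m+n; ∣m⇒∣-m)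
import Data.Integer.Properties as ℤ
open import Data.Integer.Tactic.RingSolver using (solve-∀)
open import Data.List.Base
  using (List; []; _∷_; _++_; foldr; map; mapMaybe; filter; upTo; cartesianProductWith)
import Data.List.Extrema as Extrema
open import Data.List.Membership.Propositional using (_∈_)
open import Data.List.Membership.Propositional.Properties
  using (∈-filter⁺; ∈-filter⁻; ∈-map⁺; ∈-++⁺ˡ; ∈-++⁺ʳ; ∈-upTo⁺; ∈-cartesianProductWith⁺)
open import Data.List.Relation.Unary.All as All using (All; []; _∷_)
open import Data.List.Relation.Unary.All.Properties using (++⁻ˡ; ++⁻ʳ)
open import Data.List.Relation.Unary.Any as Any using (here; there)
import Data.List.Relation.Unary.Any.Properties as Any
open import Data.Maybe.Base as Maybe using (Maybe; just; nothing)
import Data.Maybe.Relation.Unary.Any as MaybeAny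
open import Data.Nat.Base as ℕ using (ℕ; suc; NonZero)
import Data.Nat.Divisibility as ℕ
import Data.Nat.DivMod as ℕ
import Data.Nat.LCM as ℕ
import Data.Nat.Properties as ℕ
open import Data.Product.Base using (_×_; _,_; proj₁; proj₂; ∃-syntax; -,_)
open import Data.Sum.Base using (_⊎_; inj₁; inj₂; [_,_]′)
open import Data.Unit.Base using (tt)
open import Data.Vec.Base using ([]; _∷_; lookup)
open import Function.Base using (id)
open import Function.Bundles using (_⇔_; mk⇔; Equivalence)
open import Function.Construct.Identity using (⇔-id)
open import Relation.Binary.Core using (Rel)
open import Relation.Binary.PropositionalEquality
  using (_≡_; _≢_; refl; sym; trans; cong; cong₂; subst; module ≡-Reasoning)
open import Relation.Binary.Structures using (IsTotalOrder)
open import Relation.Nullary.Negation using (¬_; contradiction)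
open import Relation.Unary using (Decidable)

open Equivalence using (to; from)

private
  variable
    m n : ℕ

-- Substitution and evaluation

module _ {σ : Fin m → Term n} {M : Env n} {M′ : Env m}
         (σ-correct : ∀ i → ⟦ σ i ⟧ M ≡ lookup M′ i) where

  ⟦subᵗ⟧ : ∀ t → ⟦ subᵗ σ t ⟧ M ≡ ⟦ t ⟧ M′
  ⟦subᵗ⟧ (var i) = σ-correct i
  ⟦subᵗ⟧ (con k) = refl
  ⟦subᵗ⟧ (s ⊕ t) = cong₂ ℤ._+_ (⟦subᵗ⟧ s) (⟦subᵗ⟧ t)
  ⟦subᵗ⟧ (⊝ t)   = cong ℤ.-_ (⟦subᵗ⟧ t)
  ⟦subᵗ⟧ (k ⊙ t) = cong (k ℤ.*_) (⟦subᵗ⟧ t)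

  ⊨subᵃ : ∀ a → (M ⊨ᵃ subᵃ σ a) ≡ (M′ ⊨ᵃ a)
  ⊨subᵃ (s <ᵃ t) = cong₂ ℤ._<_ (⟦subᵗ⟧ s) (⟦subᵗ⟧ t)
  ⊨subᵃ (s ≤ᵃ t) = cong₂ ℤ._≤_ (⟦subᵗ⟧ s) (⟦subᵗ⟧ t)
  ⊨subᵃ (s ≐ t)  = cong₂ _≡_ (⟦subᵗ⟧ s) (⟦subᵗ⟧ t)
  ⊨subᵃ (d ∣ᵃ t) = cong (d Unsigned.∣_) (⟦subᵗ⟧ t)

  -- An equality of types rather than an implication, so that `cong` carries it through negation.
  ⊨sub : ∀ φ → (M ⊨ sub σ φ) ≡ (M′ ⊨ φ)
  ⊨sub (atom a) = ⊨subᵃ a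
  ⊨sub ⊤ᶠ       = refl
  ⊨sub ⊥ᶠ       = refl
  ⊨sub (¬ᶠ φ)   = cong ¬_ (⊨sub φ)
  ⊨sub (φ ∧ᶠ ψ) = cong₂ _×_ (⊨sub φ) (⊨sub ψ)
  ⊨sub (φ ∨ᶠ ψ) = cong₂ _⊎_ (⊨sub φ) (⊨sub ψ)

⊨[/x] : ∀ φ (t : Term n) ys → (ys ⊨ φ [ t /x]) ≡ (⟦ t ⟧ ys ∷ ys ⊨ φ)
⊨[/x] φ t ys = ⊨sub (λ { zero → refl ; (suc i) → refl }) φ

⟦wkᵗ⟧ : ∀ (t : Term n) v ys → ⟦ wkᵗ t ⟧ (v ∷ ys) ≡ ⟦ t ⟧ ys
⟦wkᵗ⟧ t v ys = ⟦subᵗ⟧ (λ i → refl) t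

⊨wkᵃ : ∀ (a : Atom n) v v′ ys → (v ∷ ys ⊨ᵃ wkᵃ a) ≡ (v′ ∷ ys ⊨ᵃ wkᵃ a)
⊨wkᵃ a v v′ ys =
  trans (⊨subᵃ {M′ = ys} (λ i → refl) a) (sym (⊨subᵃ (λ i → refl) a))

strengthen-wkᵗ : ∀ (t : Term n) → strengthen (wkᵗ t) ≡ just t
strengthen-wkᵗ (var i) = refl
strengthen-wkᵗ (con k) = refl
strengthen-wkᵗ (s ⊕ t) = cong₂ (Maybe.zipWith _⊕_) (strengthen-wkᵗ s) (strengthen-wkᵗ t)
strengthen-wkᵗ (⊝ t)   = cong (Maybe.map ⊝_) (strengthen-wkᵗ t)
strengthen-wkᵗ (k ⊙ t) = cong (Maybe.map (k ⊙_)) (strengthen-wkᵗ t)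

-- `⁻∞ᵃ` tests operands against `var zero`, so it reduces on `wkᵗ t` only once the head of `t` is
-- known; then `refl` suffices in each case.
term-cases : {P : Term n → Set} →
             (∀ {i} → P (var i)) → (∀ {k} → P (con k)) → (∀ {s t} → P (s ⊕ t)) →
             (∀ {t} → P (⊝ t)) → (∀ {k t} → P (k ⊙ t)) → ∀ t → P t
term-cases v c p m s (var i) = v
term-cases v c p m s (con k) = c
term-cases v c p m s (_ ⊕ _) = p
term-cases v c p m s (⊝ t)   = m
term-cases v c p m s (k ⊙ t) = s

<ᵃ-⁻∞ᵃ : ∀ (t s : Term n) → (wkᵗ s <ᵃ wkᵗ t) ⁻∞ᵃ ≡ atom (wkᵗ s <ᵃ wkᵗ t)
<ᵃ-⁻∞ᵃ (var _) = term-cases refl refl refl refl refl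
<ᵃ-⁻∞ᵃ (con _) = term-cases refl refl refl refl refl
<ᵃ-⁻∞ᵃ (_ ⊕ _) = term-cases refl refl refl refl refl
<ᵃ-⁻∞ᵃ (⊝ _)   = term-cases refl refl refl refl refl
<ᵃ-⁻∞ᵃ (_ ⊙ _) = term-cases refl refl refl refl refl

≐-⁻∞ᵃ : ∀ (t s : Term n) → (wkᵗ s ≐ wkᵗ t) ⁻∞ᵃ ≡ atom (wkᵗ s ≐ wkᵗ t)
≐-⁻∞ᵃ t = term-cases refl refl refl refl refl

wkᵃ-⁻∞ᵃ : ∀ (a : Atom n) → (wkᵃ a) ⁻∞ᵃ ≡ atom (wkᵃ a)
wkᵃ-⁻∞ᵃ (s <ᵃ t) = <ᵃ-⁻∞ᵃ t s
wkᵃ-⁻∞ᵃ (s ≤ᵃ t) = refl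
wkᵃ-⁻∞ᵃ (s ≐ t)  = ≐-⁻∞ᵃ t s
wkᵃ-⁻∞ᵃ (d ∣ᵃ t) = refl

upper-⁻∞ᵃ : ∀ (u : Term n) → (x <ᵃ wkᵗ u) ⁻∞ᵃ ≡ ⊤ᶠ
upper-⁻∞ᵃ = term-cases refl refl refl refl refl

⊨wkᵃ-⁻∞ᵃ : ∀ (a : Atom n) v v′ ys → (v ∷ ys ⊨ (wkᵃ a) ⁻∞ᵃ) ≡ (v′ ∷ ys ⊨ᵃ wkᵃ a)
⊨wkᵃ-⁻∞ᵃ a v v′ ys = trans (cong (v ∷ ys ⊨_) (wkᵃ-⁻∞ᵃ a)) (⊨wkᵃ a v v′ ys)

-- Literal-wise implication in negation normal form

⌊_⌋ : Literal n → Formula n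
⌊ pos a ⌋ = atom a
⌊ neg a ⌋ = ¬ᶠ atom a

-- There is no field for negation: in negation normal form it occurs only inside literals.
record Compositional (P : Formula n → Set) : Set where
  field
    ⊤-holds : P ⊤ᶠ
    ⊥-fails : ¬ P ⊥ᶠ
    ∧-holds : ∀ {φ ψ} → P (φ ∧ᶠ ψ) ⇔ (P φ × P ψ)
    ∨-holds : ∀ {φ ψ} → P (φ ∨ᶠ ψ) ⇔ (P φ ⊎ P ψ)

open Compositional

⊨-compositional : (M : Env n) → Compositional (M ⊨_)
⊨-compositional M = record
  { ⊤-holds = tt ; ⊥-fails = id ; ∧-holds = ⇔-id _ ; ∨-holds = ⇔-id _ }

⊨⁻∞-compositional : (M : Env (suc n)) → Compositional (λ φ → M ⊨ φ ⁻∞)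
⊨⁻∞-compositional M = record
  { ⊤-holds = tt ; ⊥-fails = id ; ∧-holds = ⇔-id _ ; ∨-holds = ⇔-id _ }

-- Conjunction and disjunction are monotone. Allowing `P` and `Q` to differ lets truth of `φ` at one
-- value of x be compared with truth of `φ ⁻∞` at another.
NNF-mono : {P Q : Formula n → Set} → Compositional P → Compositional Q →
           ∀ {φ} → NNF φ → All (λ L → P ⌊ L ⌋ → Q ⌊ L ⌋) (lits φ) → P φ → Q φ
NNF-mono cP cQ (atom a)  (i ∷ []) p = i p
NNF-mono cP cQ (¬atom a) (i ∷ []) p = i p
NNF-mono cP cQ ⊤ᶠ        _        p = ⊤-holds cQ
NNF-mono cP cQ ⊥ᶠ        _        p = contradiction p (⊥-fails cP)
NNF-mono cP cQ (_∧ᶠ_ {φ} ν μ) is p with to (∧-holds cP) p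
... | pφ , pψ = from (∧-holds cQ)
  (NNF-mono cP cQ ν (++⁻ˡ (lits φ) is) pφ , NNF-mono cP cQ μ (++⁻ʳ (lits φ) is) pψ)
NNF-mono cP cQ (_∨ᶠ_ {φ} ν μ) is p with to (∨-holds cP) p
... | inj₁ pφ = from (∨-holds cQ) (inj₁ (NNF-mono cP cQ ν (++⁻ˡ (lits φ) is) pφ))
... | inj₂ pψ = from (∨-holds cQ) (inj₂ (NNF-mono cP cQ μ (++⁻ʳ (lits φ) is) pψ))

-- Congruence

infix 4 _≡_[mod_]

_≡_[mod_] : ℤ → ℤ → ℕ → Set
u ≡ v [mod N ] = + N ∣ v ℤ.- u

≡mod-sym : ∀ {N} u v → u ≡ v [mod N ] → v ≡ u [mod N ]
≡mod-sym {N} u v N∣v-u = subst (+ N ∣_) (flip-difference u v) (∣m⇒∣-m N∣v-u)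
  where
  flip-difference : ∀ u v → ℤ.- (v ℤ.- u) ≡ u ℤ.- v
  flip-difference = solve-∀

%ℕ-≡mod : ∀ v N .{{_ : NonZero N}} → + (v ℤ.%ℕ N) ≡ v [mod N ]
%ℕ-≡mod v N = divides (v ℤ./ℕ N) (begin
  v ℤ.- r           ≡⟨ cong (ℤ._- r) (ℤ.a≡a%ℕn+[a/ℕn]*n v N) ⟩
  r ℤ.+ q ℤ.- r     ≡⟨ cancel r q ⟩
  q                 ∎)
  where
  open ≡-Reasoning
  r q : ℤ
  r = + (v ℤ.%ℕ N)
  q = v ℤ./ℕ N ℤ.* + N
  cancel : ∀ r q → r ℤ.+ q ℤ.- r ≡ q
  cancel = solve-∀

-- With b = ℓ + 1 the representative of v is ℓ + 1 + i_ℓ.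
≡mod-offset : ∀ b v N .{{_ : NonZero N}} → v ≡ b ℤ.+ + ((v ℤ.- b) ℤ.%ℕ N) [mod N ]
≡mod-offset b v N = subst (+ N ∣_) (reassociate b v (+ r))
  (≡mod-sym (+ r) (v ℤ.- b) (%ℕ-≡mod (v ℤ.- b) N))
  where
  r : ℕ
  r = (v ℤ.- b) ℤ.%ℕ N
  reassociate : ∀ b v r → r ℤ.- (v ℤ.- b) ≡ (b ℤ.+ r) ℤ.- v
  reassociate = solve-∀

-- Here `v - b` is nonnegative, and a nonnegative integer is at least its own remainder.
offset-≤ : ∀ b v N .{{_ : NonZero N}} → b ℤ.≤ v → b ℤ.+ + ((v ℤ.- b) ℤ.%ℕ N) ℤ.≤ v
offset-≤ b v N b≤v = begin
  b ℤ.+ + ((v ℤ.- b) ℤ.%ℕ N) ≤⟨ ℤ.+-monoʳ-≤ b (remainder-≤ (ℤ.i≤j⇒0≤j-i b≤v)) ⟩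
  b ℤ.+ (v ℤ.- b)            ≡⟨ cancel b v ⟩
  v                          ∎
  where
  open ℤ.≤-Reasoning
  remainder-≤ : ∀ {w} → + 0 ℤ.≤ w → + (w ℤ.%ℕ N) ℤ.≤ w
  remainder-≤ {+ w} _ = +≤+ (ℕ.m%n≤m w N)
  cancel : ∀ b v → b ℤ.+ (v ℤ.- b) ≡ v
  cancel = solve-∀

-- The two sums differ by `v - u`, a multiple of `N` and hence of `d`.
∣-+-resp-≡mod : ∀ {d N w} u v → ∣ d ∣ ℕ.∣ N → u ≡ v [mod N ] →
                d Unsigned.∣ u ℤ.+ w → d Unsigned.∣ v ℤ.+ w
∣-+-resp-≡mod {d} {N} {w} u v d∣N u≡v d∣u+w = ∣⇒∣ᵤ (subst (d ∣_) (rearrange u v w)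
  (∣m∣n⇒∣m+n (∣ᵤ⇒∣ {d} {u ℤ.+ w} d∣u+w) (∣-trans (∣ᵤ⇒∣ {d} {+ N} d∣N) u≡v)))
  where
  rearrange : ∀ u v w → (u ℤ.+ w) ℤ.+ (v ℤ.- u) ≡ v ℤ.+ w
  rearrange = solve-∀

∣-neg-+-resp-≡mod : ∀ {d N w} u v → ∣ d ∣ ℕ.∣ N → u ≡ v [mod N ] →
                    d Unsigned.∣ ℤ.- u ℤ.+ w → d Unsigned.∣ ℤ.- v ℤ.+ w
∣-neg-+-resp-≡mod {d} {N} u v d∣N u≡v = ∣-+-resp-≡mod {d} (ℤ.- u) (ℤ.- v) d∣N
  (subst (+ N ∣_) (negate-difference u v) (∣m⇒∣-m u≡v))
  where
  negate-difference : ∀ u v → ℤ.- (v ℤ.- u) ≡ (ℤ.- v) ℤ.- (ℤ.- u)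
  negate-difference = solve-∀

≡mod-below : ∀ u b N .{{_ : NonZero N}} → ∃[ v ] u ≡ v [mod N ] × v ℤ.< b
≡mod-below u b N = u ℤ.- + k ℤ.* + N , divides (ℤ.- + k) (difference u (+ k) (+ N)) , (begin-strict
  u ℤ.- + k ℤ.* + N            ≡⟨ cong (λ i → u ℤ.- i) (ℤ.pos-* k N) ⟨
  u ℤ.- + (k ℕ.* N)            ≤⟨ ℤ.+-monoʳ-≤ u (ℤ.neg-mono-≤ (+≤+ (ℕ.m≤m*n k N))) ⟩
  u ℤ.- + k                    <⟨ ℤ.+-monoʳ-< u (ℤ.neg-mono-< (ℤ.≤-<-trans (i≤+∣i∣ (u ℤ.- b)) (+<+ ℕ.≤-refl))) ⟩
  u ℤ.- (u ℤ.- b)              ≡⟨ cancel u b ⟩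
  b                            ∎)
  where
  open ℤ.≤-Reasoning
  k : ℕ
  -- As `N` is at least 1, subtracting `k * N` lowers `u` by at least `k`; the `suc` makes `k`
  -- exceed `u - b` strictly.
  k = suc ∣ u ℤ.- b ∣
  i≤+∣i∣ : ∀ i → i ℤ.≤ + ∣ i ∣
  i≤+∣i∣ (+ _)       = ℤ.≤-refl
  i≤+∣i∣ ℤ.-[1+ _ ]  = ℤ.-≤+
  difference : ∀ u k N → (u ℤ.- k ℤ.* N) ℤ.- u ≡ ℤ.- k ℤ.* N
  difference = solve-∀
  cancel : ∀ u b → u ℤ.- (u ℤ.- b) ≡ b
  cancel = solve-∀

divisor∣D : ∀ (φ : Formula n) {L} → L ∈ lits φ → divisor L ℕ.∣ D φ
divisor∣D φ = go (lits φ)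
  where
  go : ∀ Ls {L} → L ∈ Ls → divisor L ℕ.∣ foldr ℕ.lcm 1 (map divisor Ls)
  go (L ∷ Ls) (here refl) = ℕ.m∣lcm[m,n] (divisor L) _
  go (L ∷ Ls) (there L∈)  = ℕ.∣-trans (go Ls L∈) (ℕ.n∣lcm[m,n] (divisor L) _)

-- Bounds occurring in the formula

∈-mapMaybe⁺ : ∀ {A B : Set} {f : A → Maybe B} {a b as} →
              a ∈ as → f a ≡ just b → b ∈ mapMaybe f as
∈-mapMaybe⁺ {f = f} {b = b} a∈as fa≡b = Any.mapMaybe⁺ f _ (Any.map⁺ (Any.map
  (λ { refl → subst (MaybeAny.Any (b ≡_)) (sym fa≡b) (MaybeAny.just refl) }) a∈as))

∈-equals : ∀ (φ : Formula (suc n)) {e} → pos (x ≐ wkᵗ e) ∈ lits φ → e ∈ equals φ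
∈-equals φ {e} L∈ = ∈-mapMaybe⁺ L∈ (strengthen-wkᵗ e)

∈-lowers : ∀ (φ : Formula (suc n)) {ℓ} → pos (wkᵗ ℓ <ᵃ x) ∈ lits φ → ℓ ∈ lowers φ
∈-lowers φ {ℓ} L∈ = ∈-mapMaybe⁺ L∈ (strengthen-wkᵗ ℓ)

-- Counterpart of `lowerBound`, for choosing a value of x below all upper bounds.
upperBound : Literal (suc n) → Maybe (Term n)
upperBound (pos (var zero <ᵃ t)) = strengthen t
upperBound _                     = nothing

uppers : Formula (suc n) → List (Term n)
uppers φ = mapMaybe upperBound (lits φ)

∈-uppers : ∀ (φ : Formula (suc n)) {u} → pos (x <ᵃ wkᵗ u) ∈ lits φ → u ∈ uppers φ
∈-uppers φ {u} L∈ = ∈-mapMaybe⁺ L∈ (strengthen-wkᵗ u)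

below-all : (ts : List (Term n)) (ys : Env n) →
            ∃[ b ] (∀ {v t} → v ℤ.< b → t ∈ ts → v ℤ.< ⟦ t ⟧ ys)
below-all ts ys =
  -- The default `+ 0` covers the empty list; it can only lower the minimum otherwise.
  min (+ 0) values , λ v<b t∈ → ℤ.<-≤-trans v<b (All.lookup (min≤xs (+ 0) values) (∈-map⁺ _ t∈))
  where
  open Extrema ℤ.≤-totalOrder
  values : List ℤ
  values = map (λ t → ⟦ t ⟧ ys) ts

greatestLower-exists : ∀ (φ : Formula (suc n)) {v ys ℓ} → ℓ ∈ lowers φ → ⟦ ℓ ⟧ ys ℤ.< v →
                       ∃[ g ] g ∈ lowers φ × GreatestLower φ v ys g
greatestLower-exists φ {v} {ys} {ℓ} ℓ∈ ℓ<v =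
  g , proj₁ g-holds , proj₂ g-holds ,
  All.tabulate λ ℓ′∈ ℓ′<v → All.lookup (f[xs]≤f[argmax] ℓ holding) (∈-filter⁺ holds? ℓ′∈ ℓ′<v)
  where
  open Extrema ℤ.≤-totalOrder
  holds? : Decidable (λ t → ⟦ t ⟧ ys ℤ.< v)
  holds? t = ⟦ t ⟧ ys ℤ.<? v
  holding : List _
  holding = filter holds? (lowers φ)
  g : Term _
  g = argmax (λ t → ⟦ t ⟧ ys) ℓ holding
  g-holds : g ∈ lowers φ × ⟦ g ⟧ ys ℤ.< v
  -- The default `ℓ` of the maximum is itself a satisfied lower bound, so the maximiser is one in
  -- either case.
  g-holds = argmax-all (λ t → ⟦ t ⟧ ys) (ℓ∈ , ℓ<v) (All.tabulate (∈-filter⁻ holds?))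

-- Moving the value of x

module _ (φ : Formula (suc n)) (φ-nnf : NNF φ) (projectable : All ProjectableLiteral (lits φ))
         {ys : Env n} where

  ⊨divides⁺ : ∀ {d} .{{_ : ℤ.NonZero d}} w v v′ → v ≡ v′ [mod D φ ] →
              pos (d ∣ᵃ x ⊕ wkᵗ w) ∈ lits φ →
              v ∷ ys ⊨ᵃ d ∣ᵃ x ⊕ wkᵗ w → v′ ∷ ys ⊨ᵃ d ∣ᵃ x ⊕ wkᵗ w
  ⊨divides⁺ {d} w v v′ v≡v′ L∈ h rewrite ⟦wkᵗ⟧ w v ys | ⟦wkᵗ⟧ w v′ ys =
    ∣-+-resp-≡mod {d} {w = ⟦ w ⟧ ys} v v′ (divisor∣D φ L∈) v≡v′ h

  ⊨divides⁻ : ∀ {d} .{{_ : ℤ.NonZero d}} w v v′ → v ≡ v′ [mod D φ ] →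
              pos (d ∣ᵃ ⊝ x ⊕ wkᵗ w) ∈ lits φ →
              v ∷ ys ⊨ᵃ d ∣ᵃ ⊝ x ⊕ wkᵗ w → v′ ∷ ys ⊨ᵃ d ∣ᵃ ⊝ x ⊕ wkᵗ w
  ⊨divides⁻ {d} w v v′ v≡v′ L∈ h rewrite ⟦wkᵗ⟧ w v ys | ⟦wkᵗ⟧ w v′ ys =
    ∣-neg-+-resp-≡mod {d} {w = ⟦ w ⟧ ys} v v′ (divisor∣D φ L∈) v≡v′ h

  -- Equalities are false at `v`, so their implications are vacuous; upper bounds survive because
  -- `v′ ≤ v`, and divisibilities because every divisor divides `D φ`.
  descend : ∀ {v v′} → v ≡ v′ [mod D φ ] → v′ ℤ.≤ v →
            (∀ {e} → e ∈ equals φ → v ≢ ⟦ e ⟧ ys) →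
            (∀ {ℓ} → ℓ ∈ lowers φ → ⟦ ℓ ⟧ ys ℤ.< v → ⟦ ℓ ⟧ ys ℤ.< v′) →
            v ∷ ys ⊨ φ → v′ ∷ ys ⊨ φ
  descend {v} {v′} v≡v′ v′≤v no-equal lowers-kept =
    NNF-mono (⊨-compositional _) (⊨-compositional _) φ-nnf
      (All.tabulate λ L∈ → literal (All.lookup projectable L∈) L∈)
    where
    literal : ∀ {L} → ProjectableLiteral L → L ∈ lits φ → v ∷ ys ⊨ ⌊ L ⌋ → v′ ∷ ys ⊨ ⌊ L ⌋
    literal (x-free⁺ a) L∈ = subst id (⊨wkᵃ a v v′ ys)
    literal (x-free⁻ a) L∈ = subst ¬_ (⊨wkᵃ a v v′ ys)
    literal (lower ℓ) L∈ h = subst (ℤ._< v′) (sym (⟦wkᵗ⟧ ℓ v′ ys))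
      (lowers-kept {ℓ} (∈-lowers φ L∈) (subst (ℤ._< v) (⟦wkᵗ⟧ ℓ v ys) h))
    literal (upper u) L∈ h = subst (v′ ℤ.<_) (trans (⟦wkᵗ⟧ u v ys) (sym (⟦wkᵗ⟧ u v′ ys)))
      (ℤ.≤-<-trans v′≤v h)
    literal (equal e) L∈ h =
      contradiction (trans h (⟦wkᵗ⟧ e v ys)) (no-equal {e} (∈-equals φ L∈))
    literal (divides⁺ d w) L∈ = ⊨divides⁺ w v v′ v≡v′ L∈
    literal (divides⁻ d w) L∈ = ⊨divides⁻ w v v′ v≡v′ L∈

  -- The literals replaced by `⊥ᶠ` are already false at `v`, those replaced by `⊤ᶠ` become true, and
  -- the divisibilities depend only on the residue of x.
  to-⁻∞ : ∀ {v v′} → v ≡ v′ [mod D φ ] →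
          (∀ {e} → e ∈ equals φ → v ≢ ⟦ e ⟧ ys) →
          (∀ {ℓ} → ℓ ∈ lowers φ → ¬ (⟦ ℓ ⟧ ys ℤ.< v)) →
          v ∷ ys ⊨ φ → v′ ∷ ys ⊨ φ ⁻∞
  to-⁻∞ {v} {v′} v≡v′ no-equal no-lower =
    NNF-mono (⊨-compositional _) (⊨⁻∞-compositional _) φ-nnf
      (All.tabulate λ L∈ → literal (All.lookup projectable L∈) L∈)
    where
    literal : ∀ {L} → ProjectableLiteral L → L ∈ lits φ → v ∷ ys ⊨ ⌊ L ⌋ → v′ ∷ ys ⊨ ⌊ L ⌋ ⁻∞
    literal (x-free⁺ a) L∈ = subst id (sym (⊨wkᵃ-⁻∞ᵃ a v′ v ys))
    literal (x-free⁻ a) L∈ = subst ¬_ (sym (⊨wkᵃ-⁻∞ᵃ a v′ v ys))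
    literal (lower ℓ) L∈ h =
      contradiction (subst (ℤ._< v) (⟦wkᵗ⟧ ℓ v ys) h) (no-lower {ℓ} (∈-lowers φ L∈))
    literal (upper u) L∈ h = subst (v′ ∷ ys ⊨_) (sym (upper-⁻∞ᵃ u)) tt
    literal (equal e) L∈ h =
      contradiction (trans h (⟦wkᵗ⟧ e v ys)) (no-equal {e} (∈-equals φ L∈))
    literal (divides⁺ d w) L∈ = ⊨divides⁺ w v v′ v≡v′ L∈
    literal (divides⁻ d w) L∈ = ⊨divides⁻ w v v′ v≡v′ L∈

  -- Lower bounds and equalities have become `⊥ᶠ`, so they have no case to treat; upper bounds,
  -- weakened to `⊤ᶠ`, are recovered by taking `v′` small enough.
  from-⁻∞ : ∀ {v v′} → v ≡ v′ [mod D φ ] →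
            (∀ {u} → u ∈ uppers φ → v′ ℤ.< ⟦ u ⟧ ys) →
            v ∷ ys ⊨ φ ⁻∞ → v′ ∷ ys ⊨ φ
  from-⁻∞ {v} {v′} v≡v′ below-uppers =
    NNF-mono (⊨⁻∞-compositional _) (⊨-compositional _) φ-nnf
      (All.tabulate λ L∈ → literal (All.lookup projectable L∈) L∈)
    where
    literal : ∀ {L} → ProjectableLiteral L → L ∈ lits φ → v ∷ ys ⊨ ⌊ L ⌋ ⁻∞ → v′ ∷ ys ⊨ ⌊ L ⌋
    literal (x-free⁺ a) L∈ = subst id (⊨wkᵃ-⁻∞ᵃ a v v′ ys)
    literal (x-free⁻ a) L∈ = subst ¬_ (⊨wkᵃ-⁻∞ᵃ a v v′ ys)
    literal (upper u) L∈ _ =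
      subst (v′ ℤ.<_) (sym (⟦wkᵗ⟧ u v′ ys)) (below-uppers {u} (∈-uppers φ L∈))
    literal (divides⁺ d w) L∈ = ⊨divides⁺ w v v′ v≡v′ L∈
    literal (divides⁻ d w) L∈ = ⊨divides⁻ w v v′ v≡v′ L∈

-- The three cases of the projection

-- Each constructor keeps the facts that justify its branch, so that the three properties follow by
-- matching instead of repeating the case distinction of `LIAProj`.
data ProjectionCase (φ : Formula (suc n)) (v : ℤ) (ys : Env n) : Formula n → Set where
  equal    : ∀ {e} → e ∈ equals φ → HoldingEqual v ys e → ProjectionCase φ v ys (φ [ e /x])
  lower    : (∀ {e} → e ∈ equals φ → v ≢ ⟦ e ⟧ ys) →
             ∀ {ℓ} → ℓ ∈ lowers φ → GreatestLower φ v ys ℓ →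
             ProjectionCase φ v ys
               (φ [ ℓ ⊕ con (+ 1) ⊕ con ((v ℤ.- (⟦ ℓ ⟧ ys ℤ.+ + 1)) mod-D φ) /x])
  infinite : (∀ {e} → e ∈ equals φ → v ≢ ⟦ e ⟧ ys) →
             (∀ {ℓ} → ℓ ∈ lowers φ → ¬ (⟦ ℓ ⟧ ys ℤ.< v)) →
             ProjectionCase φ v ys ((φ ⁻∞) [ con (v mod-D φ) /x])

module _ {r} {_≼_ : Rel (Term n) r} (≼-isTotalOrder : IsTotalOrder _≡_ _≼_)
         {P : Term n → Set} (P? : Decidable P) where

  least-filter-just : ∀ ts {t} → least ≼-isTotalOrder (filter P? ts) ≡ just t → t ∈ ts × P t
  least-filter-just ts eq = ∈-filter⁻ P? (least-∈ (filter P? ts) eq)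
    where
    least-∈ : ∀ us {t} → least ≼-isTotalOrder us ≡ just t → t ∈ us
    least-∈ (u ∷ us) refl = [ here , there ]′
      (Extrema.argmin-sel (≼-totalOrder ≼-isTotalOrder) id u us)

  least-filter-nothing : ∀ ts → least ≼-isTotalOrder (filter P? ts) ≡ nothing →
                         ∀ {t} → t ∈ ts → ¬ P t
  least-filter-nothing ts eq t∈ Pt = least-≢nothing (∈-filter⁺ P? t∈ Pt) eq
    where
    least-≢nothing : ∀ {us t} → t ∈ us → least ≼-isTotalOrder us ≢ nothing
    least-≢nothing (here _)  ()
    least-≢nothing (there _) ()

projectionCase : ∀ {r} {_≼_ : Rel (Term n) r} (ord : IsTotalOrder _≡_ _≼_) (φ : Formula (suc n)) →
                 ∀ v ys .(p : v ∷ ys ⊨ φ) → ProjectionCase φ v ys (LIAProj ord φ (v ∷ ys) p)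
projectionCase ord φ v ys p
  with least ord (filter (holdingEqual? v ys) (equals φ)) in eq₁
     | least ord (filter (greatestLower? φ v ys) (lowers φ)) in eq₂
... | just e  | _      =
  let e∈ , v≡e = least-filter-just ord (holdingEqual? v ys) (equals φ) eq₁ in equal e∈ v≡e
... | nothing | just ℓ =
  let ℓ∈ , greatest = least-filter-just ord (greatestLower? φ v ys) (lowers φ) eq₂
  in lower (least-filter-nothing ord (holdingEqual? v ys) (equals φ) eq₁) ℓ∈ greatest
... | nothing | nothing =
  -- Any lower bound satisfied by `v` would yield a greatest one, which the empty filter excludes.
  infinite (least-filter-nothing ord (holdingEqual? v ys) (equals φ) eq₁) λ ℓ∈ ℓ<v →
    let g , g∈ , greatest = greatestLower-exists φ ℓ∈ ℓ<v
    in least-filter-nothing ord (greatestLower? φ v ys) (lowers φ) eq₂ g∈ greatest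

-- Finite image, satisfaction and soundness

module _ (φ : Formula (suc n)) where

  private instance
    D≢0 : NonZero (D φ)
    D≢0 = D-nonZero φ

  equal-images lower-images infinite-images images : List (Formula n)
  equal-images    = map (λ e → φ [ e /x]) (equals φ)
  lower-images    = cartesianProductWith (λ ℓ i → φ [ ℓ ⊕ con (+ 1) ⊕ con (+ i) /x])
                      (lowers φ) (upTo (D φ))
  infinite-images = map (λ i → (φ ⁻∞) [ con (+ i) /x]) (upTo (D φ))
  images          = equal-images ++ lower-images ++ infinite-images

  -- Both kinds of offset are remainders modulo `D φ`, so only the values in `upTo (D φ)` occur.
  ∈-images : ∀ {v ys ψ} → ProjectionCase φ v ys ψ → ψ ∈ images
  ∈-images (equal e∈ _) = ∈-++⁺ˡ (∈-map⁺ _ e∈)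
  ∈-images {v} {ys} (lower _ {ℓ} ℓ∈ _) = ∈-++⁺ʳ equal-images (∈-++⁺ˡ
    (∈-cartesianProductWith⁺ _ ℓ∈ (∈-upTo⁺ (ℤ.n%ℕd<d (v ℤ.- (⟦ ℓ ⟧ ys ℤ.+ + 1)) (D φ)))))
  ∈-images {v} (infinite _ _) = ∈-++⁺ʳ equal-images (∈-++⁺ʳ lower-images
    (∈-map⁺ _ (∈-upTo⁺ (ℤ.n%ℕd<d v (D φ)))))

  module _ (φ-nnf : NNF φ) (projectable : All ProjectableLiteral (lits φ)) where

    projection-holds : ∀ {v ys ψ} → ProjectionCase φ v ys ψ → v ∷ ys ⊨ φ → ys ⊨ ψ
    projection-holds {v} {ys} (equal {e} _ v≡e) h =
      subst id (sym (⊨[/x] φ e ys)) (subst (λ u → u ∷ ys ⊨ φ) v≡e h)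
    projection-holds {v} {ys} (lower no-equal {ℓ} _ (ℓ<v , greatest)) h =
      subst id (sym (⊨[/x] φ _ ys))
        (descend φ φ-nnf projectable (≡mod-offset b v (D φ)) (offset-≤ b v (D φ) b≤v) no-equal
          -- A lower bound `ℓ′` satisfied by `v` has `ℓ′ ≤ ℓ < ℓ + 1`, and the new value of x is at
          -- least `ℓ + 1`.
          (λ ℓ′∈ ℓ′<v → ℤ.≤-<-trans (All.lookup greatest ℓ′∈ ℓ′<v) (ℤ.<-≤-trans ℓ<b (ℤ.i≤i+j b _))) h)
      where
      b : ℤ
      b = ⟦ ℓ ⟧ ys ℤ.+ + 1
      suc≡b : ℤ.suc (⟦ ℓ ⟧ ys) ≡ b
      suc≡b = ℤ.+-comm (+ 1) (⟦ ℓ ⟧ ys)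
      b≤v : b ℤ.≤ v
      b≤v = subst (ℤ._≤ v) suc≡b (ℤ.i<j⇒suc[i]≤j ℓ<v)
      ℓ<b : ⟦ ℓ ⟧ ys ℤ.< b
      ℓ<b = ℤ.suc[i]≤j⇒i<j (ℤ.≤-reflexive suc≡b)
    projection-holds {v} {ys} (infinite no-equal no-lower) h =
      subst id (sym (⊨[/x] (φ ⁻∞) _ ys))
        (to-⁻∞ φ φ-nnf projectable (≡mod-sym _ v (%ℕ-≡mod v (D φ))) no-equal no-lower h)

    -- The projection may come from a model with other values `zs`. In the first two cases the
    -- substituted term, evaluated at `ys`, is the witness for x; in the third, a value with the
    -- same residue is taken below all upper bounds at `ys`.
    projection-sound : ∀ {v zs ψ} → ProjectionCase φ v zs ψ →
                       ∀ ys → ys ⊨ ψ → ∃[ u ] (u ∷ ys ⊨ φ)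
    projection-sound (equal _ _)    ys h = -, subst id (⊨[/x] φ _ ys) h
    projection-sound (lower _ _ _)  ys h = -, subst id (⊨[/x] φ _ ys) h
    projection-sound {v} (infinite _ _) ys h =
      let b , below       = below-all (uppers φ) ys
          u , ≡u , u<b    = ≡mod-below (v mod-D φ) b (D φ)
      in u , from-⁻∞ φ φ-nnf projectable ≡u (below u<b) (subst id (⊨[/x] (φ ⁻∞) _ ys) h)

lemma7 : ∀ {n r} {_≼_ : Rel (Term n) r} (≼-isTotalOrder : IsTotalOrder _≡_ _≼_) →
    (λₘ : Formula (suc n)) → NNF λₘ → All ProjectableLiteral (lits λₘ) →
    IsModelBasedProjection 1 λₘ (LIAProj ≼-isTotalOrder λₘ)
lemma7 ord φ φ-nnf projectable = record
  { finite-image = images φ , λ { (v ∷ ys) p → ∈-images φ (projectionCase ord φ v ys p) }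
  ; equivalent   = λ ys → mk⇔
      -- A model over `ys` satisfies its own projection.
      (λ { (v ∷ [] , p) → v ∷ ys , p , holds v ys p })
      (λ { (v ∷ zs , p , h) →
           let u , q = projection-sound φ φ-nnf projectable (projectionCase ord φ v zs p) ys h
           in u ∷ [] , q })
  ; satisfied    = λ { (v ∷ ys) p → holds v ys p }
  }
  where
  holds : ∀ v ys (p : v ∷ ys ⊨ φ) → ys ⊨ LIAProj ord φ (v ∷ ys) p
  holds v ys p = projection-holds φ φ-nnf projectable (projectionCase ord φ v ys p) p
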